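{- Let $k\ge 2$ be a natural number and let $S$ be a non-sparse $k$-automatic subset of $\mathbb{N}$ with $\gcd(S)=1$. Then there exist effectively computable natural numbers $N=N(S)$ and $M=M(S)$ such that every natural number $n\ge M$ can be expressed as a sum of at most $N$ elements from $S$. Moreover, if the minimal DFA accepting $S$ has $m$ states, then $N\le 5k^{16m+3}$ and $M\le 3k^{16m+5}$.
   Context: $\mathbb{N}=\{0,1,2,\ldots\}$. The canonical base-$k$ expansion of $n\in\mathbb{N}$ is the word over $\{0,1,\ldots,k-1\}$ representing $n$ in base $k$ without leading zeros (the empty word for $n=0$). A set $S\subseteq\mathbb{N}$ is $k$-automatic if the language of canonical base-$k$ expansions of its elements is regular, i.e., accepted by a deterministic finite automaton (DFA, with total transition function $\delta:Q\times\Sigma\to Q$). By convention expansions are read by automata starting with the least significant digit, and "the minimal DFA accepting $S$" means the DFA with the fewest states accepting the language of canonical base-$k$ expansions of elements of $S$ read in this direction. Let $\pi_S(x)=\#\{n\le x : n\in S\}$. $S$ is sparse if there is an integer $d\ge 0$ with $\pi_S(x)=O((\log x)^d)$; otherwise $S$ is non-sparse. $\gcd(S)$ is the greatest common divisor of all elements of $S$. A sum of at most $N$ elements of $S$ is a sum $x_1+\cdots+x_i$ with $1\le i\le N$ and $x_1,\ldots,x_i\in S$ (repetitions allowed). "Effectively computable" means computable by an algorithm from $k$ and a DFA for $S$; the bounds assert that $N$ and $M$ with the stated property may be chosen satisfying them. -}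

module Defs where

open import Data.Digit using (Digit; Expansion; fromDigits; toDigits)
open import Data.Fin using (Fin; zero; suc; toℕ)
open import Data.Fin.Subset using (Subset; _∈_)
open import Data.Fin.Subset.Properties using (_∈?_)
open import Data.List using (List; []; _∷_; foldl; last; length; filter; upTo; sum)
open import Data.List.Relation.Unary.All using (All)
import Data.Maybe.Relation.Unary.All as Maybe
open import Data.Nat using (ℕ; _+_; _*_; _^_; _≤_)
open import Data.Nat.Divisibility using (_∣_)
open import Data.Nat.Logarithm using (⌊log₂_⌋)
open import Data.Nat.Properties using (_≤?_)
open import Data.Product using (∃; ∃-syntax; Σ-syntax; _×_; _,_; proj₁; proj₂)
open import Function using (_⇔_; mk⇔; Equivalence)
open import Level using (0ℓ)
open import Relation.Binary.PropositionalEquality using (_≡_; _≢_; refl; cong; subst; sym; trans)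
open import Relation.Nullary using (¬_)
open import Relation.Nullary.Decidable using (map; fromWitness)
open import Relation.Unary using (Pred; Decidable)

-- Expansions are lists of digits with the least significant digit first, so
-- the leading digit is the last element of the list; the canonical expansion
-- of 0 is [].
IsCanonicalExpansion : ∀ {k} → Expansion k → ℕ → Set
IsCanonicalExpansion w n = fromDigits w ≡ n × Maybe.All (λ d → toℕ d ≢ 0) (last w)

record DFA (k : ℕ) : Set where
  field
    states : ℕ
    start  : Fin states
    final  : Subset states
    δ      : Fin states → Digit k → Fin states

  Accepts : Expansion k → Set
  Accepts w = foldl δ start w ∈ final

open DFA public using (states; Accepts)

-- In particular A rejects every word with superfluous leading zeros.
Recognises : ∀ {k} → DFA k → Pred ℕ 0ℓ → Set
Recognises A S = ∀ w → Accepts A w ⇔ (∃[ n ] S n × IsCanonicalExpansion w n)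

Automatic : ℕ → Pred ℕ 0ℓ → Set
Automatic k S = Σ[ A ∈ DFA k ] Recognises A S

IsMinimalDFA : ∀ {k} → DFA k → Pred ℕ 0ℓ → Set
IsMinimalDFA {k} A S =
  Recognises A S × (∀ (B : DFA k) → Recognises B S → states A ≤ states B)

private
  consDigit : ∀ {k} (d : Digit k) (w : Expansion k) →
              Maybe.All (λ e → toℕ e ≢ 0) (last w) →
              ∃[ v ] IsCanonicalExpansion {k} v (fromDigits (d ∷ w))
  consDigit zero    []      _ = [] , refl , Maybe.nothing
  consDigit (suc d) []      _ = suc d ∷ [] , refl , Maybe.just (λ ())
  consDigit d       (e ∷ w) c = d ∷ e ∷ w , refl , c

  canonicalise : ∀ {k} (w : Expansion k) → ∃[ v ] IsCanonicalExpansion v (fromDigits w)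
  canonicalise []          = [] , refl , Maybe.nothing
  canonicalise {k} (d ∷ w) with canonicalise w
  ... | v , v≡w , c with consDigit d v c
  ...   | u , u≡dv , c′ = u , trans u≡dv (cong (λ i → toℕ d + i * k) v≡w) , c′

canonicalExpansion : ∀ {k} → 2 ≤ k → ∀ n → ∃[ w ] IsCanonicalExpansion {k} w n
canonicalExpansion {k} 2≤k n with toDigits k {fromWitness 2≤k} n
... | w , w≡n = subst (λ i → ∃[ v ] IsCanonicalExpansion v i) w≡n (canonicalise w)

-- Used only so that elements of an automatic set can be counted.
automatic⇒decidable : ∀ {k S} → 2 ≤ k → Automatic k S → Decidable S
automatic⇒decidable {k} {S} 2≤k (A , rec) n with canonicalExpansion 2≤k n
... | w , w≡n , c =
  map (mk⇔ to′ (λ n∈S → Equivalence.from (rec w) (n , n∈S , w≡n , c)))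
      (foldl (DFA.δ A) (DFA.start A) w ∈? DFA.final A)
  where
  to′ : Accepts A w → S n
  to′ acc with Equivalence.to (rec w) acc
  ... | m , m∈S , w≡m , _ = subst S (trans (sym w≡m) w≡n) m∈S

π : ∀ {S : Pred ℕ 0ℓ} → Decidable S → ℕ → ℕ
π S? x = length (filter S? (upTo (1 + x)))

-- π_S(x) = O((log x)^d) for some d, as x → ∞.  Replacing log x by ⌊log₂ x⌋
-- changes it by at most a constant factor for x ≥ 2, which C absorbs.
Sparse : ∀ {S : Pred ℕ 0ℓ} → Decidable S → Set
Sparse S? = ∃[ d ] ∃[ C ] ∃[ x₀ ] ∀ x → x₀ ≤ x → π S? x ≤ C * ⌊log₂ x ⌋ ^ d

IsGCD : Pred ℕ 0ℓ → ℕ → Set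
IsGCD S g = (∀ n → S n → g ∣ n) × (∀ d → (∀ n → S n → d ∣ n) → d ∣ g)

SumOfAtMost : ℕ → Pred ℕ 0ℓ → ℕ → Set
SumOfAtMost N S n =
  ∃[ xs ] 1 ≤ length xs × length xs ≤ N × All S xs × sum xs ≡ n

-- An algorithm is a function definable in Agda, which has only the base and
-- an automaton as input (no proofs about it).  For a set S, such a function
-- computes the number v if it returns v on every automaton for S.
DFAAlgorithm : Set
DFAAlgorithm = (k : ℕ) → DFA k → ℕ

Computes : DFAAlgorithm → ℕ → Pred ℕ 0ℓ → ℕ → Set
Computes f k S v = ∀ (A : DFA k) → Recognises A S → f k A ≡ v

{-# OPTIONS --safe #-}

-- If S is not sparse, some state q that is reachable and co-reachable has two
-- distinct letters leading back to it. Concatenating the two resulting loops in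
-- either order gives words y₀ ≠ y₁ of equal length with u{y₀,y₁}*v accepted. With
-- K = k^|y₀|, sums of r(K − 1) values of words u{y₀,y₁}ᵗv fill an arithmetic
-- progression of r(Kᵗ − 1) + 1 terms with difference D = k^|u|([y₁] − [y₀]), which
-- is longer than the gap to the progression for r + 1 as soon as r is large.
-- Pumping modulo g shows that the elements of S below k^(2m) already have gcd 1,
-- so sums of boundedly many of them cover all residues modulo D.
-- The number m of states of the minimal DFA is found by exhaustive search.

module Submission where

open import Defs
open import Data.Bool using (true)
open import Data.Digit using (Digit; Expansion; fromDigits)
open import Data.Fin using (Fin; zero; suc; toℕ; combine; finToFun; funToFin)
import Data.Fin.Properties as Fin
open import Data.Fin.Subset using (Subset; _∈_; ∣_∣)
open import Data.Fin.Subset.Properties using (_∈?_; p⊆q⇒∣p∣≤∣q∣; p⊂q⇒∣p∣<∣q∣; ∣p∣≤n; anySubset?)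
open import Data.List as List using (List; []; _∷_; _++_; length; foldl; replicate; take; drop; last; concat; upTo; filter)
open import Data.List.Properties using (length-++; length-++-comm; length-map; length-replicate; length-take; length-drop; length-filter; length-upTo; foldl-++; take++drop≡id)
import Data.List.Membership.Propositional as Mem
open import Data.List.Membership.Propositional.Properties using (∈-concat⁺′; ∈-tabulate⁺; ∈-∃++; ∈-++⁺ˡ; ∈-++⁺ʳ; ∈-++⁻; ∈-upTo⁺; ∈-upTo⁻; ∈-filter⁺; ∈-filter⁻; ∈-map⁺)
open import Data.List.Relation.Binary.Subset.Propositional using (_⊆_)
open import Data.List.Relation.Unary.All as All using (All; []; _∷_)
open import Data.List.Relation.Unary.All.Properties using (++⁺; replicate⁺)
open import Data.List.Relation.Unary.AllPairs using ([]; _∷_)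
open import Data.List.Relation.Unary.Any using (here; there)
open import Data.List.Relation.Unary.Unique.Propositional using (Unique)
import Data.List.Relation.Unary.Unique.Propositional.Properties as Unique
import Data.Maybe.Relation.Unary.All as Maybe
open import Data.Nat using (ℕ; zero; suc; pred; _+_; _*_; _^_; _∸_; _≤_; _<_; z≤n; s≤s; _≤?_; _<?_; NonZero; >-nonZero)
open import Data.Nat.DivMod using (_/_; _%_; m/n*n≤m; m≡m%n+[m/n]*n; m%n<n; m<n⇒m%n≡m; [m+kn]%n≡m%n)
open import Data.Nat.Divisibility using (_∣_; divides; 1∣_; ∣-refl; ∣-trans; ∣m+n∣m⇒∣n; ∣m∣n⇒∣m+n; ∣n⇒∣m*n; n∣m*n)
open import Data.Nat.GCD using (gcd; gcd[m,n]∣m; gcd[m,n]∣n; gcd-GCD; module Bézout)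
open import Data.Nat.Induction using (<-wellFounded)
open import Data.Nat.ListAction using (sum)
open import Data.Nat.ListAction.Properties using (sum-++)
open import Data.Nat.Logarithm using (⌊log₂_⌋; ⌊log₂⌋-mono-≤; ⌊log₂[2^n]⌋≡n)
open import Data.Nat.Properties
open import Data.Nat.Tactic.RingSolver using (solve-∀)
open import Data.Product using (Σ-syntax; ∃-syntax; _×_; _,_; proj₁; proj₂; uncurry)
open import Data.Sum using (inj₁; inj₂)
open import Data.Vec using (tabulate)
open import Data.Vec.Properties using (lookup∘tabulate; lookup⇒[]=; []=⇒lookup)
open import Function using (_⇔_; Equivalence; mk⇔; _∘_; id)
open import Function.Construct.Composition using (_⇔-∘_)
open import Function.Construct.Identity using (⇔-id)
open import Function.Construct.Symmetry using (⇔-sym)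
open import Induction.WellFounded using (Acc; acc)
open import Level using (0ℓ)
open import Relation.Binary.Definitions using (tri<; tri≈; tri>)
open import Relation.Binary.PropositionalEquality using (_≡_; _≢_; refl; cong; cong₂; sym; trans; subst; module ≡-Reasoning)
open import Relation.Nullary using (Dec; yes; no; does; ¬_; ¬?; contradiction; _×-dec_; _⊎-dec_; _→-dec_)
open import Relation.Nullary.Decidable using (True; map; map′; dec-true; decidable-stable; toWitness)
open import Relation.Unary using (Pred; Decidable)

-- Sums of pumped words

-- Equal length of the two loops is what makes sums controllable: replacing y₀ by y₁ in block i,
-- counted from 0, changes a value by `D` Kⁱ whatever the other blocks are, so a sum depends only on
-- how many summands use y₁ in each block. These counts act as digits in base `K`. Taking r(K - 1)
-- summands lets each count run at least from 0 to K - 1, so no multiple of `D` is skipped. The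
-- obstacle is that the number of summands must stay bounded while n grows. Hence the number t of
-- blocks, not r, follows the size of n: t is the stage at which n - `Z` lies between `R` times
-- `block t` and `R` times `block (suc t)`. As `block` grows at most by the factor 2K per stage, r
-- stays between `R` and 2K`R`. The number of terms of a progression and the gap to the next one are
-- both of order Kᵗ, so one threshold `R` serves all t. `Z` bounds the sum of the elements that
-- correct the residue; it is reserved in n beforehand.

bracket : ∀ (f : ℕ → ℕ) {n} c a → f a ≤ n → n < f (c + a) → ∃[ t ] a ≤ t × f t ≤ n × n < f (suc t)
bracket f     zero    a fa≤n n<fa = contradiction fa≤n (<⇒≱ n<fa)
bracket f {n} (suc c) a fa≤n n<fca with n <? f (suc a)
... | yes n<f = a , ≤-refl , fa≤n , n<f
... | no  n≮f with bracket f c (suc a) (≮⇒≥ n≮f) (subst (λ i → n < f i) (sym (+-suc c a)) n<fca)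
...   | t , a<t , ft≤n , n<ft = t , <⇒≤ a<t , ft≤n , n<ft

-- A digit may be as large as `b`, which is at least `κ`, so the ranges for neighbouring `i` overlap
-- or touch. As long as `j` exceeds `b`, one unit `suc κ` can be carried over to `i`.
split-digit : ∀ κ b a j → κ ≤ b → j ≤ b + suc κ * a →
              ∃[ d ] ∃[ i ] d ≤ b × i ≤ a × j ≡ d + suc κ * i
split-digit κ b a j κ≤b j≤ with j ≤? b
... | yes j≤b = j , 0 , j≤b , z≤n , sym (trans (cong (j +_) (*-zeroʳ κ)) (+-identityʳ j))
split-digit κ b zero    j κ≤b j≤ | no j≰b =
  contradiction (≤-trans j≤ (≤-reflexive (trans (cong (b +_) (*-zeroʳ κ)) (+-identityʳ b)))) j≰b
split-digit κ b (suc a) j κ≤b j≤ | no j≰b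
  with split-digit κ b a (j ∸ suc κ) κ≤b
         (m≤n+o⇒m∸n≤o j (suc κ) (≤-trans j≤ (≤-reflexive (lem b κ a))))
  where
  lem : ∀ b κ a → b + suc κ * suc a ≡ suc κ + (b + suc κ * a)
  lem = solve-∀
... | d , i , d≤b , i≤a , eq = d , suc i , d≤b , s≤s i≤a , (begin
  j                           ≡⟨ m+[n∸m]≡n (≤-trans (s≤s κ≤b) (≰⇒> j≰b)) ⟨
  suc κ + (j ∸ suc κ)         ≡⟨ cong (suc κ +_) eq ⟩
  suc κ + (d + suc κ * i)     ≡⟨ lem′ κ d i ⟩
  d + suc κ * suc i           ∎)
  where
  open ≡-Reasoning
  lem′ : ∀ κ d i → suc κ + (d + suc κ * i) ≡ d + suc κ * suc i
  lem′ = solve-∀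

-- The values of the words w v with w ∈ {y₀, y₁}ᵗ, where y₀ and y₁ have equal
-- length, K is the base to that length, and V, Y and Y + Δ are the values of
-- v, y₀ and y₁.
data Pumped (K Y Δ V : ℕ) : ℕ → ℕ → Set where
  tail : Pumped K Y Δ V 0 V
  low  : ∀ {t y} → Pumped K Y Δ V t y → Pumped K Y Δ V (suc t) (Y + K * y)
  high : ∀ {t y} → Pumped K Y Δ V t y → Pumped K Y Δ V (suc t) (Y + Δ + K * y)

module PumpedSums (κ Y Δ V : ℕ) where
  K : ℕ
  K = suc κ

  least : ℕ → ℕ
  least zero    = V
  least (suc t) = Y + K * least t

  repdigit : ℕ → ℕ
  repdigit zero    = 0
  repdigit (suc t) = κ + K * repdigit t

  suc-repdigit : ∀ t → suc (repdigit t) ≡ K ^ t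
  suc-repdigit zero    = refl
  suc-repdigit (suc t) = trans (lem κ (repdigit t)) (cong (K *_) (suc-repdigit t))
    where
    lem : ∀ κ x → suc (κ + suc κ * x) ≡ suc κ * suc x
    lem = solve-∀

  -- One block is put in front of every summand: y₁ for the first `d` of them, y₀ for the others.
  -- The new block is the least significant one, so the old sum is multiplied by `K`.
  raise : ∀ {t} ys d → All (Pumped K Y Δ V t) ys → d ≤ length ys →
          ∃[ xs ] All (Pumped K Y Δ V (suc t)) xs × length xs ≡ length ys ×
                  sum xs ≡ length ys * Y + d * Δ + K * sum ys
  raise []       .0      []       z≤n     = [] , [] , refl , sym (*-zeroʳ κ)
  raise (y ∷ ys) zero    (p ∷ ps) z≤n     with raise ys zero ps z≤n
  ... | xs , pxs , len , eq =
    _ , low p ∷ pxs , cong suc len ,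
    trans (cong (Y + K * y +_) eq) (lem Y K y (length ys) (sum ys))
    where
    lem : ∀ Y K y l s → Y + K * y + (l * Y + 0 + K * s) ≡ Y + l * Y + 0 + K * (y + s)
    lem = solve-∀
  raise (y ∷ ys) (suc d) (p ∷ ps) (s≤s d≤) with raise ys d ps d≤
  ... | xs , pxs , len , eq =
    _ , high p ∷ pxs , cong suc len ,
    trans (cong (Y + Δ + K * y +_) eq) (lem Y Δ d K y (length ys) (sum ys))
    where
    lem : ∀ Y Δ d K y l s → Y + Δ + K * y + (l * Y + d * Δ + K * s) ≡
                            Y + l * Y + (Δ + d * Δ) + K * (y + s)
    lem = solve-∀

  -- With r (K − 1) summands the number of summands whose i-th block is y₁ can
  -- be any digit up to r (K − 1), so all multiples of Δ up to r (Kᵗ − 1) Δ occur.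
  pumped-sum : ∀ r .⦃ _ : NonZero r ⦄ t j → j ≤ r * repdigit t →
    ∃[ ys ] All (Pumped K Y Δ V t) ys × length ys ≡ r * κ ×
            sum ys ≡ r * κ * least t + Δ * j
  pumped-sum r zero    j j≤ with ≤-trans j≤ (≤-reflexive (*-zeroʳ r))
  ... | z≤n = go (r * κ)
    where
    go : ∀ s → ∃[ ys ] All (Pumped K Y Δ V 0) ys × length ys ≡ s × sum ys ≡ s * V + Δ * 0
    go zero    = [] , [] , refl , sym (*-zeroʳ Δ)
    go (suc s) with go s
    ... | ys , ps , len , eq =
      V ∷ ys , tail ∷ ps , cong suc len ,
      trans (cong (V +_) eq) (sym (+-assoc V (s * V) (Δ * 0)))
  pumped-sum r (suc t) j j≤
    with split-digit κ (r * κ) (r * repdigit t) j (m≤n*m κ r)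
           (≤-trans j≤ (≤-reflexive (lem r κ (repdigit t))))
    where
    lem : ∀ r κ x → r * (κ + suc κ * x) ≡ r * κ + suc κ * (r * x)
    lem = solve-∀
  ... | d , i , d≤ , i≤ , refl with pumped-sum r t i i≤
  ...   | ys , ps , len , eq with raise ys d ps (≤-trans d≤ (≤-reflexive (sym len)))
  ...     | xs , qs , len′ , eq′ = xs , qs , trans len′ len , (begin
    sum xs                                                    ≡⟨ eq′ ⟩
    length ys * Y + d * Δ + K * sum ys                        ≡⟨ cong₂ (λ l s → l * Y + d * Δ + K * s) len eq ⟩
    s * Y + d * Δ + K * (s * least t + Δ * i)                 ≡⟨ lem s Y d Δ K (least t) i ⟩
    s * (Y + K * least t) + Δ * (d + K * i)                   ∎)
    where
    open ≡-Reasoning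
    s = r * κ
    lem : ∀ s Y d Δ K l i → s * Y + d * Δ + K * (s * l + Δ * i) ≡ s * (Y + K * l) + Δ * (d + K * i)
    lem = solve-∀

affine-sum : ∀ {P S : Pred ℕ 0ℓ} U A → (∀ {y} → P y → S (U + A * y)) → ∀ ys → All P ys →
  ∃[ xs ] All S xs × length xs ≡ length ys × sum xs ≡ length ys * U + A * sum ys
affine-sum U A f []       []       = [] , [] , refl , sym (*-zeroʳ A)
affine-sum U A f (y ∷ ys) (p ∷ ps) with affine-sum U A f ys ps
... | xs , qs , len , eq = _ , f p ∷ qs , cong suc len ,
  trans (cong (U + A * y +_) eq) (lem U A y (length ys) (sum ys))
  where
  lem : ∀ U A y l s → U + A * y + (l * U + A * s) ≡ U + l * U + A * (y + s)
  lem = solve-∀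

-- `U` is the value of u, `A` and `B` are the base to the lengths of u and v, and `A * Δ` is the
-- difference of the progressions. `C` and `Z` bound the number and the sum of the elements that
-- correct a residue. The congruence is an equation with a multiple of the modulus on each side,
-- which avoids subtraction.
module PumpedBasis
  (S : Pred ℕ 0ℓ) (κ U A Y Δ V B C Z : ℕ)
  (1≤κ : 1 ≤ κ) (U<A : U < A) (1≤Δ : 1 ≤ Δ) (V<B : V < B)
  (1≤Y+KV : 1 ≤ Y + suc κ * V) (Y<K : Y < suc κ)
  (pumped∈S : ∀ {t y} → Pumped (suc κ) Y Δ V t y → S (U + A * y))
  (residue : ∀ n → ∃[ xs ] All S xs × length xs ≤ C × sum xs ≤ Z ×
                   (∃[ a ] ∃[ b ] sum xs + a * (A * Δ) ≡ n + b * (A * Δ)))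
  where
  open PumpedSums κ Y Δ V

  -- The sum of K - 1 copies of the value of u y₀ᵗ v. The progression for r starts at `r * block t`,
  -- so `block t` is also the gap to the start of the next one.
  block : ℕ → ℕ
  block t = κ * (U + A * least t)

  R : ℕ
  R = 2 * (K * (A * B) + Z)

  private
    1≤A : 1 ≤ A
    1≤A = ≤-trans (s≤s z≤n) U<A

    least-grows : ∀ t → suc t ≤ least (suc t)
    least-grows zero    = 1≤Y+KV
    least-grows (suc t) = begin
      suc (suc t)                          ≤⟨ +-mono-≤ (≤-trans (s≤s z≤n) (least-grows t)) (least-grows t) ⟩
      l + l                                ≡⟨ cong (l +_) (+-identityʳ l) ⟨
      2 * l                                ≤⟨ *-monoˡ-≤ l (s≤s 1≤κ) ⟩
      K * l                                ≤⟨ m≤n+m (K * l) Y ⟩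
      Y + K * l                            ∎
      where
      open ≤-Reasoning
      l = least (suc t)

    block-grows : ∀ t → suc t ≤ block (suc t)
    block-grows t = begin
      suc t             ≤⟨ least-grows t ⟩
      l                 ≡⟨ *-identityˡ l ⟨
      1 * l             ≤⟨ *-monoˡ-≤ l 1≤A ⟩
      A * l             ≤⟨ m≤n+m (A * l) U ⟩
      U + A * l         ≡⟨ *-identityˡ _ ⟨
      1 * (U + A * l)   ≤⟨ *-monoˡ-≤ (U + A * l) 1≤κ ⟩
      block (suc t)     ∎
      where
      open ≤-Reasoning
      l = least (suc t)

    -- Once `least` is positive, `Y` is at most `K` times it, so one more block costs at most a
    -- factor `2 * K`. This is what bounds r from above.
    block-ratio : ∀ t → block (suc (suc t)) ≤ 2 * K * block (suc t)
    block-ratio t = begin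
      κ * (U + A * (Y + K * l))           ≤⟨ *-monoʳ-≤ κ (+-mono-≤ U≤ (*-monoʳ-≤ A Y≤)) ⟩
      κ * (2 * K * U + A * (K * l + K * l)) ≡⟨ lem κ K U A l ⟩
      2 * K * (κ * (U + A * l))           ∎
      where
      open ≤-Reasoning
      l = least (suc t)
      U≤ : U ≤ 2 * K * U
      U≤ = m≤n*m U (2 * K)
      Y≤ : Y + K * l ≤ K * l + K * l
      Y≤ = +-monoˡ-≤ (K * l) (≤-trans (<⇒≤ Y<K) (≤-trans (≤-reflexive (sym (*-identityʳ K)))
             (*-monoʳ-≤ K (≤-trans (s≤s z≤n) (least-grows t)))))
      lem : ∀ κ K U A l → κ * (2 * K * U + A * (K * l + K * l)) ≡ 2 * K * (κ * (U + A * l))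
      lem = solve-∀

    least< : ∀ t → suc (least t) ≤ K ^ t * B
    least< zero    = ≤-trans V<B (≤-reflexive (sym (+-identityʳ B)))
    least< (suc t) = begin
      suc Y + K * least t      ≤⟨ +-monoˡ-≤ (K * least t) Y<K ⟩
      K + K * least t          ≡⟨ *-suc K (least t) ⟨
      K * suc (least t)        ≤⟨ *-monoʳ-≤ K (least< t) ⟩
      K * (K ^ t * B)          ≡⟨ *-assoc K (K ^ t) B ⟨
      K ^ suc t * B            ∎
      where open ≤-Reasoning

  block≤ : ∀ t → block t ≤ K * (A * B) * K ^ t
  block≤ t = begin
    κ * (U + A * least t)       ≤⟨ *-mono-≤ (n≤1+n κ) (+-monoˡ-≤ (A * least t) (<⇒≤ U<A)) ⟩
    K * (A + A * least t)       ≡⟨ cong (K *_) (*-suc A (least t)) ⟨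
    K * (A * suc (least t))     ≤⟨ *-monoʳ-≤ K (*-monoʳ-≤ A (least< t)) ⟩
    K * (A * (K ^ t * B))       ≡⟨ lem K A (K ^ t) B ⟩
    K * (A * B) * K ^ t         ∎
    where
    open ≤-Reasoning
    lem : ∀ K A P B → K * (A * (P * B)) ≡ K * (A * B) * P
    lem = solve-∀

  private
    -- Both `block` and `Z` are bounded by a constant times `K ^ suc t`, which is ρ + 1 and hence at
    -- most 2ρ; this is the factor 2 in `R`. The count of terms is compared with the gap directly,
    -- since the difference of the progression is at least 1.
    window : ∀ r t → R ≤ r → block (suc t) + Z ≤ r * repdigit (suc t)
    window r t R≤r = begin
      block (suc t) + Z                        ≤⟨ +-mono-≤ (block≤ (suc t)) (m≤m*n Z (K ^ suc t) ⦃ m^n≢0 K (suc t) ⦄) ⟩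
      K * (A * B) * K ^ suc t + Z * K ^ suc t  ≡⟨ *-distribʳ-+ (K ^ suc t) (K * (A * B)) Z ⟨
      H * K ^ suc t                            ≡⟨ cong (H *_) (suc-repdigit (suc t)) ⟨
      H * suc ρ                                ≤⟨ *-monoʳ-≤ H (+-monoˡ-≤ ρ (≤-trans 1≤κ (m≤m+n κ (K * repdigit t)))) ⟩
      H * (ρ + ρ)                              ≡⟨ lem H ρ ⟩
      R * ρ                                    ≤⟨ *-monoˡ-≤ ρ R≤r ⟩
      r * ρ                                    ∎
      where
      open ≤-Reasoning
      H = K * (A * B) + Z
      ρ = repdigit (suc t)
      lem : ∀ H ρ → H * (ρ + ρ) ≡ 2 * H * ρ
      lem = solve-∀

    1≤R : 1 ≤ R
    1≤R = *-mono-≤ {1} {2} {1} (s≤s z≤n)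
            (≤-trans (*-mono-≤ {1} {K} {1} (s≤s z≤n) (*-mono-≤ {1} {A} {1} 1≤A (≤-trans (s≤s z≤n) V<B)))
              (m≤m+n (K * (A * B)) Z))

  pumped-basis : ∀ n → R * block 1 + Z ≤ n → SumOfAtMost (C + R * (2 * K) * κ) S n
  pumped-basis n M≤n
    -- The search starts at t = 1, since with no block to vary the progression has a single term. It
    -- ends within `n` stages because `block (suc n)` exceeds `n`.
    with bracket (λ t → R * block t + Z) n 1 M≤n
           (subst (λ i → n < R * block i + Z) (+-comm 1 n)
             (≤-trans (block-grows n)
               (≤-trans (m≤n*m (block (suc n)) R ⦃ >-nonZero 1≤R ⦄) (m≤m+n _ Z))))
  ... | suc t , _ , lower , upper = answer
    where
    open ≤-Reasoning
    b = block (suc t)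
    1≤b : 1 ≤ b
    1≤b = ≤-trans (s≤s z≤n) (block-grows t)
    instance
      b≢0 : NonZero b
      b≢0 = >-nonZero 1≤b
    -- `Z` is set aside before dividing, so the rest `n′` is at least `Z` and the correcting
    -- elements can be subtracted from it.
    r = (n ∸ Z) / b
    Z≤n : Z ≤ n
    Z≤n = ≤-trans (m≤n+m Z (R * b)) lower
    rb≤ : r * b ≤ n ∸ Z
    rb≤ = m/n*n≤m (n ∸ Z) b
    <rb : n ∸ Z < b + r * b
    <rb = begin-strict
      n ∸ Z                        ≡⟨ m≡m%n+[m/n]*n (n ∸ Z) b ⟩
      _ + r * b                    <⟨ +-monoˡ-< (r * b) (m%n<n (n ∸ Z) b) ⟩
      b + r * b                    ∎
    Rb≤ : R * b ≤ n ∸ Z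
    Rb≤ = ≤-trans (≤-reflexive (sym (m+n∸n≡m (R * b) Z))) (∸-monoˡ-≤ Z lower)
    R≤r : R ≤ r
    R≤r = ≤-pred (*-cancelʳ-< b R (suc r) (≤-<-trans Rb≤ <rb))
    r≤ : r ≤ R * (2 * K)
    r≤ = <⇒≤ (*-cancelʳ-< b r (R * (2 * K)) (begin-strict
      r * b                        ≤⟨ rb≤ ⟩
      n ∸ Z                        <⟨ ∸-monoˡ-< upper Z≤n ⟩
      R * block (2 + t) + Z ∸ Z    ≡⟨ m+n∸n≡m (R * block (2 + t)) Z ⟩
      R * block (2 + t)            ≤⟨ *-monoʳ-≤ R (block-ratio t) ⟩
      R * (2 * K * b)              ≡⟨ *-assoc R (2 * K) b ⟨
      R * (2 * K) * b              ∎))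
    D = A * Δ
    instance
      r≢0 : NonZero r
      r≢0 = >-nonZero (≤-trans 1≤R R≤r)
      D≢0 : NonZero D
      D≢0 = >-nonZero (*-mono-≤ 1≤A 1≤Δ)
    n′ = n ∸ r * b
    rb≤n : r * b ≤ n
    rb≤n = ≤-trans rb≤ (m∸n≤m n Z)
    Z≤n′ : Z ≤ n′
    Z≤n′ = begin
      Z                    ≡⟨ m∸[m∸n]≡n Z≤n ⟨
      n ∸ (n ∸ Z)          ≤⟨ ∸-monoʳ-≤ n rb≤ ⟩
      n′                   ∎
    n′≤ : n′ ≤ b + Z
    n′≤ = m≤n+o⇒m∸n≤o n (r * b) (begin
      n                    ≡⟨ m∸n+n≡m Z≤n ⟨
      n ∸ Z + Z            ≤⟨ +-monoˡ-≤ Z (<⇒≤ <rb) ⟩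
      b + r * b + Z        ≡⟨ lem b (r * b) Z ⟩
      r * b + (b + Z)      ∎)
      where
      lem : ∀ b x Z → b + x + Z ≡ x + (b + Z)
      lem = solve-∀
    answer : SumOfAtMost (C + R * (2 * K) * κ) S n
    answer with residue n′
    ... | xs , xs∈S , len≤C , sum≤Z , a , c , cong-D
      with ∣m+n∣m⇒∣n {D} {c * D} {n′ ∸ sum xs} (divides a eq) (n∣m*n c)
      where
      eq : c * D + (n′ ∸ sum xs) ≡ a * D
      eq = +-cancelˡ-≡ (sum xs) _ _ (≡.begin
        sum xs + (c * D + (n′ ∸ sum xs)) ≡.≡⟨ lem (sum xs) (c * D) (n′ ∸ sum xs) ⟩
        sum xs + (n′ ∸ sum xs) + c * D   ≡.≡⟨ cong (_+ c * D) (m+[n∸m]≡n (≤-trans sum≤Z Z≤n′)) ⟩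
        n′ + c * D                       ≡.≡⟨ cong-D ⟨
        sum xs + a * D                   ≡.∎)
        where
        module ≡ = ≡-Reasoning
        lem : ∀ x y z → x + (y + z) ≡ x + z + y
        lem = solve-∀
    ... | divides j jD with pumped-sum r (suc t) j j≤
      where
      j≤ : j ≤ r * repdigit (suc t)
      j≤ = begin
        j                        ≤⟨ m≤m*n j D ⟩
        j * D                    ≡⟨ jD ⟨
        n′ ∸ sum xs              ≤⟨ m∸n≤m n′ (sum xs) ⟩
        n′                       ≤⟨ n′≤ ⟩
        b + Z                    ≤⟨ window r t R≤r ⟩
        r * repdigit (suc t)     ∎
    ... | ys , pys , lenys , sumys with affine-sum U A pumped∈S ys pys
    ... | zs , zs∈S , lenzs , sumzs =
      xs ++ zs , len≥1 , len≤ , ++⁺ xs∈S zs∈S , total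
      where
      len-eq : length (xs ++ zs) ≡ length xs + r * κ
      len-eq = trans (length-++ xs) (cong (length xs +_) (trans lenzs lenys))
      len≥1 : 1 ≤ length (xs ++ zs)
      len≥1 = begin
        1                        ≤⟨ *-mono-≤ (≤-trans 1≤R R≤r) 1≤κ ⟩
        r * κ                    ≤⟨ m≤n+m (r * κ) (length xs) ⟩
        length xs + r * κ        ≡⟨ len-eq ⟨
        length (xs ++ zs)        ∎
      len≤ : length (xs ++ zs) ≤ C + R * (2 * K) * κ
      len≤ = ≤-trans (≤-reflexive len-eq) (+-mono-≤ len≤C (*-monoˡ-≤ κ r≤))
      sum-zs : sum zs ≡ r * b + j * D
      sum-zs = trans sumzs (trans (cong₂ (λ l s → l * U + A * s) lenys sumys)
        (lem r κ U A (least (suc t)) Δ j))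
        where
        lem : ∀ r κ U A l Δ j → r * κ * U + A * (r * κ * l + Δ * j) ≡
                                r * (κ * (U + A * l)) + j * (A * Δ)
        lem = solve-∀
      total : sum (xs ++ zs) ≡ n
      total = ≡.begin
        sum (xs ++ zs)                       ≡.≡⟨ sum-++ xs zs ⟩
        sum xs + sum zs                      ≡.≡⟨ cong (sum xs +_) (trans sum-zs (cong (r * b +_) (sym jD))) ⟩
        sum xs + (r * b + (n′ ∸ sum xs))     ≡.≡⟨ lem (sum xs) (r * b) (n′ ∸ sum xs) ⟩
        r * b + (sum xs + (n′ ∸ sum xs))     ≡.≡⟨ cong (r * b +_) (m+[n∸m]≡n (≤-trans sum≤Z Z≤n′)) ⟩
        r * b + n′                           ≡.≡⟨ m+[n∸m]≡n rb≤n ⟩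
        n                                    ≡.∎
        where
        module ≡ = ≡-Reasoning
        lem : ∀ x y z → x + (y + z) ≡ y + (x + z)
        lem = solve-∀
  pumped-basis n M≤n | zero , () , _

-- Residues

sum-replicate : ∀ c s → sum (replicate c s) ≡ c * s
sum-replicate zero    s = refl
sum-replicate (suc c) s = cong (s +_) (sum-replicate c s)

sum-bounded : ∀ {X} xs → All (_≤ X) xs → sum xs ≤ length xs * X
sum-bounded []       []       = z≤n
sum-bounded (x ∷ xs) (p ∷ ps) = +-mono-≤ p (sum-bounded xs ps)

-- Modulo `D` a negative Bézout coefficient -y may be replaced by y(D - 1). The two cases differ in
-- whether `s` or `g` carries the negative coefficient.
bézout-mod : ∀ D ⦃ _ : NonZero D ⦄ g s n → gcd g s ∣ n →
             ∃[ c ] ∃[ n′ ] ∃[ f ] g ∣ n′ × c * s + n′ ≡ n + f * D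
bézout-mod D@(suc D′) g s n (divides q refl) with Bézout.identity (gcd-GCD g s)
... | Bézout.+- x y eq = q * y * D′ , q * x * g , q * y * s , n∣m*n (q * x) , (begin
  q * y * D′ * s + q * x * g           ≡⟨ lem₁ q y D′ s x g ⟩
  q * y * D′ * s + q * (x * g)         ≡⟨ cong (λ z → q * y * D′ * s + q * z) eq ⟨
  q * y * D′ * s + q * (d + y * s)     ≡⟨ lem₂ q y D′ s d ⟩
  q * d + q * y * s * suc D′           ∎)
  where
  open ≡-Reasoning
  d = gcd g s
  lem₁ : ∀ q y D′ s x g → q * y * D′ * s + q * x * g ≡ q * y * D′ * s + q * (x * g)
  lem₁ = solve-∀
  lem₂ : ∀ q y D′ s d → q * y * D′ * s + q * (d + y * s) ≡ q * d + q * y * s * suc D′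
  lem₂ = solve-∀
... | Bézout.-+ x y eq = q * y , q * x * D′ * g , q * x * g , n∣m*n (q * x * D′) , (begin
  q * y * s + q * x * D′ * g           ≡⟨ cong (_+ q * x * D′ * g) (*-assoc q y s) ⟩
  q * (y * s) + q * x * D′ * g         ≡⟨ cong (λ z → q * z + q * x * D′ * g) eq ⟨
  q * (d + x * g) + q * x * D′ * g     ≡⟨ lem q d x g D′ ⟩
  q * d + q * x * g * suc D′           ∎)
  where
  open ≡-Reasoning
  d = gcd g s
  lem : ∀ q d x g D′ → q * (d + x * g) + q * x * D′ * g ≡ q * d + q * x * g * suc D′
  lem = solve-∀

-- The induction starts from the gcd `D`, whose multiples need no summand at all. Each further
-- element lowers the gcd by Bézout, and its multiplicity can be reduced modulo `D`, so it is used
-- fewer than `D` times.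
residue-span : ∀ {P : Pred ℕ 0ℓ} D ⦃ _ : NonZero D ⦄ ss → All P ss →
  ∃[ g ] g ∣ D × All (g ∣_) ss ×
    (∀ n → g ∣ n → ∃[ xs ] All P xs × length xs ≤ length ss * D ×
                   (∃[ a ] ∃[ b ] sum xs + a * D ≡ n + b * D))
residue-span D []       []       =
  D , ∣-refl , [] , λ { .(q * D) (divides q refl) → [] , [] , z≤n , q , 0 , sym (+-identityʳ _) }
residue-span D (s ∷ ss) (p ∷ ps) with residue-span D ss ps
... | g , g∣D , g∣ss , span =
  gcd g s , ∣-trans (gcd[m,n]∣m g s) g∣D ,
  gcd[m,n]∣n g s ∷ All.map (∣-trans (gcd[m,n]∣m g s)) g∣ss , span′
  where
  span′ : ∀ n → gcd g s ∣ n → _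
  span′ n d∣n with bézout-mod D g s n d∣n
  ... | c , n′ , f , g∣n′ , eq with span n′ g∣n′
  ...   | xs , pxs , len , a , b , eq′ =
    replicate r s ++ xs , ++⁺ (replicate⁺ r p) pxs ,
    ≤-trans (≤-reflexive (trans (length-++ (replicate r s)) (cong (_+ length xs) (length-replicate r))))
            (+-mono-≤ (<⇒≤ (m%n<n c D)) len) ,
    a + e * s , f + b , (begin
      sum (replicate r s ++ xs) + (a + e * s) * D   ≡⟨ cong (_+ (a + e * s) * D) (trans (sum-++ (replicate r s) xs) (cong (_+ sum xs) (sum-replicate r s))) ⟩
      r * s + sum xs + (a + e * s) * D              ≡⟨ lem₁ r s (sum xs) a e D ⟩
      (r + e * D) * s + (sum xs + a * D)            ≡⟨ cong₂ (λ x y → x * s + y) (sym (m≡m%n+[m/n]*n c D)) eq′ ⟩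
      c * s + (n′ + b * D)                          ≡⟨ +-assoc (c * s) n′ (b * D) ⟨
      c * s + n′ + b * D                            ≡⟨ cong (_+ b * D) eq ⟩
      n + f * D + b * D                             ≡⟨ lem₂ n f b D ⟩
      n + (f + b) * D                               ∎)
    where
    open ≡-Reasoning
    r = c % D
    e = c / D
    lem₁ : ∀ r s x a e D → r * s + x + (a + e * s) * D ≡ (r + e * D) * s + (x + a * D)
    lem₁ = solve-∀
    lem₂ : ∀ n f b D → n + f * D + b * D ≡ n + (f + b) * D
    lem₂ = solve-∀

-- Expansions and automata

fromDigits-++ : ∀ {k} (xs ys : Expansion k) →
                fromDigits (xs ++ ys) ≡ fromDigits xs + k ^ length xs * fromDigits ys
fromDigits-++     []       ys = sym (+-identityʳ _)
fromDigits-++ {k} (x ∷ xs) ys =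
  trans (cong (λ i → toℕ x + i * k) (fromDigits-++ xs ys))
        (lem (toℕ x) (fromDigits xs) (k ^ length xs) (fromDigits ys) k)
  where
  lem : ∀ x a p b k → x + (a + p * b) * k ≡ x + a * k + k * p * b
  lem = solve-∀

fromDigits-< : ∀ {k} (w : Expansion k) → fromDigits w < k ^ length w
fromDigits-<     []      = s≤s z≤n
fromDigits-< {k} (d ∷ w) = begin
  suc (toℕ d) + fromDigits w * k   ≤⟨ +-monoˡ-≤ (fromDigits w * k) (Fin.toℕ<n d) ⟩
  k + fromDigits w * k             ≤⟨ *-monoˡ-≤ k (fromDigits-< w) ⟩
  k ^ length w * k                 ≡⟨ *-comm (k ^ length w) k ⟩
  k ^ length (d ∷ w)               ∎
  where open ≤-Reasoning

canonical-≥ : ∀ {k} (d : Digit k) w → Maybe.All (λ e → toℕ e ≢ 0) (last (d ∷ w)) →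
              k ^ length w ≤ fromDigits (d ∷ w)
canonical-≥     d []      (Maybe.just d≢0) = ≤-trans (n≢0⇒n>0 d≢0) (m≤m+n (toℕ d) 0)
canonical-≥ {k} d (e ∷ w) c = begin
  k * k ^ length w                    ≤⟨ *-monoʳ-≤ k (canonical-≥ e w c) ⟩
  k * fromDigits (e ∷ w)              ≡⟨ *-comm k (fromDigits (e ∷ w)) ⟩
  fromDigits (e ∷ w) * k              ≤⟨ m≤n+m _ (toℕ d) ⟩
  toℕ d + fromDigits (e ∷ w) * k      ∎
  where open ≤-Reasoning

fromDigits-head : ∀ {k} (a b : Digit k) v w → fromDigits (a ∷ v) ≡ fromDigits (b ∷ w) → a ≡ b
fromDigits-head {k} a b v w eq = Fin.toℕ-injective (begin
  toℕ a                                  ≡⟨ m<n⇒m%n≡m (Fin.toℕ<n a) ⟨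
  toℕ a % k                              ≡⟨ [m+kn]%n≡m%n (toℕ a) (fromDigits v) k ⟨
  fromDigits (a ∷ v) % k                 ≡⟨ cong (_% k) eq ⟩
  fromDigits (b ∷ w) % k                 ≡⟨ [m+kn]%n≡m%n (toℕ b) (fromDigits w) k ⟩
  toℕ b % k                              ≡⟨ m<n⇒m%n≡m (Fin.toℕ<n b) ⟩
  toℕ b                                  ∎)
  where
  open ≡-Reasoning
  instance
    k≢0 : NonZero k
    k≢0 = Fin.nonZeroIndex a

module _ {Q : Set} {k s} (code : Q → Fin s) (code-injective : ∀ {p q} → code p ≡ code q → p ≡ q)
         (δ : Q → Digit k → Q) where

  -- Two of the prefixes of lengths 0 to `s` lead to the same state, and the factor between them is
  -- cut out. States enter through an injective code because pairs of states of two automata are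
  -- treated as well.
  shorten : ∀ q w → s ≤ length w → ∃[ v ] length v < length w × foldl δ q v ≡ foldl δ q w
  shorten q w s≤ with Fin.pigeonhole (n<1+n s) (λ i → code (foldl δ q (take (toℕ i) w)))
  ... | i , j , i<j , eq = take (toℕ i) w ++ drop (toℕ j) w , shorter , (begin
    foldl δ q (take (toℕ i) w ++ drop (toℕ j) w)         ≡⟨ foldl-++ δ q (take (toℕ i) w) _ ⟩
    foldl δ (foldl δ q (take (toℕ i) w)) (drop (toℕ j) w) ≡⟨ cong (λ p → foldl δ p (drop (toℕ j) w)) (code-injective eq) ⟩
    foldl δ (foldl δ q (take (toℕ j) w)) (drop (toℕ j) w) ≡⟨ foldl-++ δ q (take (toℕ j) w) _ ⟨
    foldl δ q (take (toℕ j) w ++ drop (toℕ j) w)         ≡⟨ cong (foldl δ q) (take++drop≡id (toℕ j) w) ⟩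
    foldl δ q w                                          ∎)
    where
    open ≡-Reasoning
    module ≤ = ≤-Reasoning
    j≤ : toℕ j ≤ length w
    j≤ = ≤-trans (≤-pred (Fin.toℕ<n j)) s≤
    shorter : length (take (toℕ i) w ++ drop (toℕ j) w) < length w
    shorter = ≤.begin-strict
      length (take (toℕ i) w ++ drop (toℕ j) w)          ≤.≡⟨ length-++ (take (toℕ i) w) ⟩
      length (take (toℕ i) w) + length (drop (toℕ j) w)  ≤.≡⟨ cong₂ _+_ (length-take (toℕ i) w) (length-drop (toℕ j) w) ⟩
      _ + (length w ∸ toℕ j)                             ≤.≤⟨ +-monoˡ-≤ (length w ∸ toℕ j) (m⊓n≤m (toℕ i) (length w)) ⟩
      toℕ i + (length w ∸ toℕ j)                         ≤.<⟨ +-monoˡ-< (length w ∸ toℕ j) i<j ⟩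
      toℕ j + (length w ∸ toℕ j)                         ≤.≡⟨ m+[n∸m]≡n j≤ ⟩
      length w                                           ≤.∎

  short-path : ∀ q w → ∃[ v ] length v < s × foldl δ q v ≡ foldl δ q w
  short-path q w = go w (<-wellFounded (length w))
    where
    go : ∀ w → Acc _<_ (length w) → ∃[ v ] length v < s × foldl δ q v ≡ foldl δ q w
    go w (acc rs) with length w <? s
    ... | yes lt = w , lt , refl
    ... | no  ≮s with shorten q w (≮⇒≥ ≮s)
    ...   | v , v<w , eq with go v (rs v<w)
    ...     | u , u<s , eq′ = u , u<s , trans eq′ eq

anyWord? : ∀ {k} {P : Pred (Expansion k) 0ℓ} → Decidable P → ∀ n → Dec (∃[ w ] length w < n × P w)
anyWord? P? zero    = no λ ()
anyWord? P? (suc n) =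
  map (mk⇔ (λ { (inj₁ p) → [] , s≤s z≤n , p ; (inj₂ (a , w , lt , p)) → a ∷ w , s≤s lt , p })
           (λ { ([] , _ , p) → inj₁ p ; (a ∷ w , s≤s lt , p) → inj₂ (a , w , lt , p) }))
      (P? [] ⊎-dec Fin.any? (λ a → anyWord? (λ w → P? (a ∷ w)) n))

module Reachability {k} (A : DFA k) where
  open DFA A using (start; final; δ)

  s : ℕ
  s = states A

  Reachable : Fin s → Fin s → Set
  Reachable p q = ∃[ w ] foldl δ p w ≡ q

  short-reach : ∀ {p q} → Reachable p q → ∃[ w ] length w < s × foldl δ p w ≡ q
  short-reach {p} (w , eq) with short-path id id δ p w
  ... | v , lt , eq′ = v , lt , trans eq′ eq

  reachable? : ∀ p q → Dec (Reachable p q)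
  reachable? p q = map (mk⇔ (λ { (w , _ , eq) → w , eq }) short-reach)
                       (anyWord? (λ w → foldl δ p w Fin.≟ q) s)

  reachable-trans : ∀ {p q r} → Reachable p q → Reachable q r → Reachable p r
  reachable-trans {p} (v , refl) (w , eq) = v ++ w , trans (foldl-++ δ p v w) eq

  Live : Fin s → Set
  Live q = ∃[ f ] Reachable q f × f ∈ final

  Branching : Fin s → Set
  Branching q = ∃[ a ] ∃[ b ] a ≢ b × Reachable (δ q a) q × Reachable (δ q b) q

  live? : Decidable Live
  live? q = Fin.any? λ f → reachable? q f ×-dec f ∈? final

  branching? : Decidable Branching
  branching? q = Fin.any? λ a → Fin.any? λ b →
    ¬? (a Fin.≟ b) ×-dec reachable? (δ q a) q ×-dec reachable? (δ q b) q

  Pumpable : Set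
  Pumpable = ∃[ q ] Reachable start q × Live q × Branching q

  pumpable? : Dec Pumpable
  pumpable? = Fin.any? λ q → reachable? start q ×-dec live? q ×-dec branching? q

module Recognised {k} (A : DFA k) (S : Pred ℕ 0ℓ) (rec : Recognises A S) where
  open DFA A using (start; final; δ)
  open Reachability A

  accepted⇒∈ : ∀ w → Accepts A w → S (fromDigits w)
  accepted⇒∈ w p with Equivalence.to (rec w) p
  ... | n , n∈S , eq , _ = subst S (sym eq) n∈S

  accepted⇒canonical : ∀ w → Accepts A w → Maybe.All (λ d → toℕ d ≢ 0) (last w)
  accepted⇒canonical w p with Equivalence.to (rec w) p
  ... | n , n∈S , eq , c = c

  expansion : 2 ≤ k → ∀ n → S n → ∃[ w ] Accepts A w × IsCanonicalExpansion w n
  expansion 2≤k n n∈S with canonicalExpansion 2≤k n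
  ... | w , can = w , Equivalence.from (rec w) (n , n∈S , can) , can

  -- A word of length 2s has a removable factor in each half; the values with
  -- either or both factors removed determine its residue modulo g.
  divides-small⇒divides : .⦃ _ : NonZero k ⦄ → ∀ g → (∀ n → S n → n < k ^ (2 * s) → g ∣ n) →
                          ∀ w → Accepts A w → g ∣ fromDigits w
  divides-small⇒divides g small w = go w (<-wellFounded (length w))
    where
    go : ∀ w → Acc _<_ (length w) → Accepts A w → g ∣ fromDigits w
    go w (acc rs) w∈ with length w <? 2 * s
    ... | yes lt = small _ (accepted⇒∈ w w∈) (<-≤-trans (fromDigits-< w) (^-monoʳ-≤ k (<⇒≤ lt)))
    ... | no  ≮2s = subst (g ∣_) (sym whole) (∣m+n∣m⇒∣n (subst (g ∣_) (sym key) (∣m∣n⇒∣m+n d₁ (∣n⇒∣m*n E d₂))) (∣n⇒∣m*n E d₃))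
      where
      2s≤ : s + s ≤ length w
      2s≤ = ≤-trans (≤-reflexive (cong (s +_) (sym (+-identityʳ s)))) (≮⇒≥ ≮2s)
      x = take s w
      y = drop s w
      len-x : length x ≡ s
      len-x = trans (length-take s w) (m≤n⇒m⊓n≡m (≤-trans (m≤m+n s s) 2s≤))
      s≤y : s ≤ length y
      s≤y = ≤-trans (≤-trans (≤-reflexive (sym (m+n∸n≡m s s))) (∸-monoˡ-≤ s 2s≤)) (≤-reflexive (sym (length-drop s w)))
      sx = shorten id id δ start x (≤-reflexive (sym len-x))
      sy = shorten id id δ (foldl δ start x) y s≤y
      x′ = proj₁ sx
      y′ = proj₁ sy
      x′<x : length x′ < length x
      x′<x = proj₁ (proj₂ sx)
      y′<y : length y′ < length y
      y′<y = proj₁ (proj₂ sy)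
      len-w : length x + length y ≡ length w
      len-w = trans (sym (length-++ x)) (cong length (take++drop≡id s w))
      run : ∀ u v → foldl δ start u ≡ foldl δ start x → foldl δ (foldl δ start x) v ≡ foldl δ (foldl δ start x) y →
            length u + length v < length w → g ∣ fromDigits u + k ^ length u * fromDigits v
      run u v equ eqv lt = subst (g ∣_) (fromDigits-++ u v)
        (go (u ++ v) (rs (subst (_< length w) (sym (length-++ u)) lt)) (subst (_∈ final) (sym final-state) w∈))
        where
        final-state : foldl δ start (u ++ v) ≡ foldl δ start w
        final-state = trans (foldl-++ δ start u v)
          (trans (cong (λ q → foldl δ q v) equ)
            (trans eqv (trans (sym (foldl-++ δ start x y)) (cong (foldl δ start) (take++drop≡id s w)))))
      e  = fromDigits y
      e′ = fromDigits y′
      E  = k ^ (length x ∸ length x′)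
      A′ = k ^ length x′
      d₁ : g ∣ fromDigits x + k ^ length x * e′
      d₁ = run x y′ refl (proj₂ (proj₂ sy)) (<-≤-trans (+-monoʳ-< (length x) y′<y) (≤-reflexive len-w))
      d₂ : g ∣ fromDigits x′ + A′ * e
      d₂ = run x′ y (proj₂ (proj₂ sx)) refl (<-≤-trans (+-monoˡ-< (length y) x′<x) (≤-reflexive len-w))
      d₃ : g ∣ fromDigits x′ + A′ * e′
      d₃ = run x′ y′ (proj₂ (proj₂ sx)) (proj₂ (proj₂ sy)) (<-≤-trans (+-mono-< x′<x y′<y) (≤-reflexive len-w))
      power : k ^ length x ≡ A′ * E
      power = trans (cong (k ^_) (sym (m+[n∸m]≡n (<⇒≤ x′<x)))) (^-distribˡ-+-* k (length x′) _)
      whole : fromDigits w ≡ fromDigits x + k ^ length x * e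
      whole = trans (cong fromDigits (sym (take++drop≡id s w))) (fromDigits-++ x y)
      -- Replacing `y′` by `y` after `x` changes the value by `E` times what it changes after `x′`.
      -- Written with additions only, this leaves the value of w as the one term not yet known to be
      -- divisible by `g`.
      key : E * (fromDigits x′ + A′ * e′) + (fromDigits x + k ^ length x * e) ≡
            fromDigits x + k ^ length x * e′ + E * (fromDigits x′ + A′ * e)
      key rewrite power = lem E (fromDigits x′) A′ e′ (fromDigits x) e
        where
        lem : ∀ E a A b c e → E * (a + A * b) + (c + A * E * e) ≡ c + A * E * b + E * (a + A * e)
        lem = solve-∀

-- Automata without branching are sparse

^-distribʳ-* : ∀ m n o → (m * n) ^ o ≡ m ^ o * n ^ o
^-distribʳ-* m n zero    = refl
^-distribʳ-* m n (suc o) = trans (cong (m * n *_) (^-distribʳ-* m n o)) (lem m n (m ^ o) (n ^ o))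
  where
  lem : ∀ m n x y → m * n * (x * y) ≡ m * x * (n * y)
  lem = solve-∀

does≡true⁻ : ∀ {A : Set} (a? : Dec A) → does a? ≡ true → A
does≡true⁻ (yes a) _ = a

unique-⊆⇒length-≤ : ∀ {A : Set} {xs ys : List A} → Unique xs → xs ⊆ ys → length xs ≤ length ys
unique-⊆⇒length-≤ {xs = []}     _          _   = z≤n
unique-⊆⇒length-≤ {xs = x ∷ xs} (x∉ ∷ uxs) sub with ∈-∃++ (sub (here refl))
... | as , bs , refl = begin
  suc (length xs)               ≤⟨ s≤s (unique-⊆⇒length-≤ uxs sub′) ⟩
  suc (length (as ++ bs))       ≡⟨ cong suc (length-++ as) ⟩
  suc (length as + length bs)   ≡⟨ +-suc (length as) (length bs) ⟨
  length as + suc (length bs)   ≡⟨ length-++ as ⟨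
  length (as ++ x ∷ bs)         ∎
  where
  open ≤-Reasoning
  sub′ : xs ⊆ as ++ bs
  sub′ y∈xs with ∈-++⁻ as (sub (there y∈xs))
  ... | inj₁ y∈as         = ∈-++⁺ˡ y∈as
  ... | inj₂ (here refl)  = contradiction refl (All.lookup x∉ y∈xs)
  ... | inj₂ (there y∈bs) = ∈-++⁺ʳ as y∈bs

module _ {A : Set} where

  length-concat-tabulate-≤ : ∀ {k} (f : Fin k → List A) {c} → (∀ a → length (f a) ≤ c) →
                             length (concat (List.tabulate f)) ≤ k * c
  length-concat-tabulate-≤ {zero}  f f≤ = z≤n
  length-concat-tabulate-≤ {suc k} f f≤ =
    ≤-trans (≤-reflexive (length-++ (f zero)))
            (+-mono-≤ (f≤ zero) (length-concat-tabulate-≤ (f ∘ suc) (f≤ ∘ suc)))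

  -- The index `a` will be the one letter leading back to the current state, whose words are bounded
  -- by a higher power than those of the other letters.
  length-concat-tabulate-≤-except :
    ∀ {k} (f : Fin k → List A) {c d} a → length (f a) ≤ d → (∀ b → b ≢ a → length (f b) ≤ c) →
    length (concat (List.tabulate f)) ≤ d + k * c
  length-concat-tabulate-≤-except {suc k} f {c} {d} zero    fa≤ f≤ = begin
    length (f zero ++ rest)        ≡⟨ length-++ (f zero) ⟩
    length (f zero) + length rest  ≤⟨ +-mono-≤ fa≤ (length-concat-tabulate-≤ (f ∘ suc) (λ b → f≤ (suc b) λ ())) ⟩
    d + k * c                      ≤⟨ +-monoʳ-≤ d (m≤n+m (k * c) c) ⟩
    d + (c + k * c)                ∎
    where
    open ≤-Reasoning
    rest = concat (List.tabulate (f ∘ suc))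
  length-concat-tabulate-≤-except {suc k} f {c} {d} (suc a) fa≤ f≤ = begin
    length (f zero ++ rest)        ≡⟨ length-++ (f zero) ⟩
    length (f zero) + length rest  ≤⟨ +-mono-≤ (f≤ zero λ ()) (length-concat-tabulate-≤-except (f ∘ suc) a fa≤
                                        (λ b b≢a → f≤ (suc b) (b≢a ∘ Fin.suc-injective))) ⟩
    c + (d + k * c)                ≡⟨ lem c d (k * c) ⟩
    d + (c + k * c)                ∎
    where
    open ≤-Reasoning
    rest = concat (List.tabulate (f ∘ suc))
    lem : ∀ c d e → c + (d + e) ≡ d + (c + e)
    lem = solve-∀

module Growth {k} (A : DFA k) where
  open DFA A using (start; final; δ)
  open Reachability A

  acceptedFrom : Fin s → ℕ → List (Expansion k)
  acceptedFrom q zero    with q ∈? final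
  ... | yes _ = [] ∷ []
  ... | no  _ = []
  acceptedFrom q (suc n) =
    acceptedFrom q 0 ++ concat (List.tabulate λ a → List.map (a ∷_) (acceptedFrom (δ q a) n))

  acceptedFrom-complete : ∀ q n w → foldl δ q w ∈ final → length w ≤ n → w Mem.∈ acceptedFrom q n
  acceptedFrom-complete q zero    []      p _ with q ∈? final
  ... | yes _ = here refl
  ... | no ¬p = contradiction p ¬p
  acceptedFrom-complete q (suc n) []      p _        = ∈-++⁺ˡ (acceptedFrom-complete q 0 [] p z≤n)
  acceptedFrom-complete q (suc n) (a ∷ w) p (s≤s le) =
    ∈-++⁺ʳ (acceptedFrom q 0)
      (∈-concat⁺′ (∈-map⁺ (a ∷_) (acceptedFrom-complete (δ q a) n w p le)) (∈-tabulate⁺ a))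

  acceptedFrom-zero-≤ : ∀ q → length (acceptedFrom q 0) ≤ 1
  acceptedFrom-zero-≤ q with q ∈? final
  ... | yes _ = s≤s z≤n
  ... | no  _ = z≤n

  acceptedFrom-dead : ∀ q n → ¬ Live q → length (acceptedFrom q n) ≤ 0
  acceptedFrom-dead q zero    dead with q ∈? final
  ... | yes p = contradiction (q , ([] , refl) , p) dead
  ... | no  _ = z≤n
  acceptedFrom-dead q (suc n) dead =
    ≤-trans (≤-reflexive (length-++ (acceptedFrom q 0)))
      (+-mono-≤ (acceptedFrom-dead q 0 dead)
        (≤-trans (length-concat-tabulate-≤ _ λ a →
                   ≤-trans (≤-reflexive (length-map (a ∷_) (acceptedFrom (δ q a) n)))
                     (acceptedFrom-dead (δ q a) n λ { (f , r , p) → dead (f , reachable-trans (a ∷ [] , refl) r , p) }))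
          (≤-reflexive (*-zeroʳ k))))

  reach : Fin s → Subset s
  reach q = tabulate (λ r → does (reachable? q r))

  ∈reach⁺ : ∀ {q r} → Reachable q r → r ∈ reach q
  ∈reach⁺ {q} {r} p =
    lookup⇒[]= r (reach q) (trans (lookup∘tabulate (does ∘ reachable? q) r) (dec-true (reachable? q r) p))

  ∈reach⁻ : ∀ {q r} → r ∈ reach q → Reachable q r
  ∈reach⁻ {q} {r} r∈ =
    does≡true⁻ (reachable? q r) (trans (sym (lookup∘tabulate (does ∘ reachable? q) r)) ([]=⇒lookup r∈))

  rank : Fin s → ℕ
  rank q = ∣ reach q ∣

  rank-step-≤ : ∀ q a → rank (δ q a) ≤ rank q
  rank-step-≤ q a = p⊆q⇒∣p∣≤∣q∣ (λ r∈ → ∈reach⁺ (reachable-trans (a ∷ [] , refl) (∈reach⁻ r∈)))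

  -- The state `q` reaches itself by the empty word but is lost after the step.
  rank-step-< : ∀ q a → ¬ Reachable (δ q a) q → rank (δ q a) < rank q
  rank-step-< q a ¬r = p⊂q⇒∣p∣<∣q∣
    ((λ r∈ → ∈reach⁺ (reachable-trans (a ∷ [] , refl) (∈reach⁻ r∈))) ,
     q , ∈reach⁺ ([] , refl) , λ q∈ → ¬r (∈reach⁻ q∈))

  -- Without branching at most one letter leads back to q, and all others
  -- decrease the rank.
  acceptedFrom-≤ : ¬ Pumpable → ∀ h q → Reachable start q → rank q < h → ∀ n →
                   length (acceptedFrom q n) ≤ (suc k * suc n) ^ h
  acceptedFrom-≤ ¬pump (suc h) q r rk zero =
    ≤-trans (acceptedFrom-zero-≤ q) (m^n>0 (suc k * 1) (suc h))
  acceptedFrom-≤ ¬pump (suc h) q r rk (suc n) with live? q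
  -- A dead state may well have several letters leading back to it, as a rejecting sink does, so it
  -- is counted separately.
  ... | no dead = ≤-trans (acceptedFrom-dead q (suc n) dead) z≤n
  ... | yes live = begin
    length (acceptedFrom q (suc n))                     ≡⟨ length-++ (acceptedFrom q 0) ⟩
    length (acceptedFrom q 0) + length (concat (List.tabulate next))
                                                        ≤⟨ +-mono-≤ (acceptedFrom-zero-≤ q) children ⟩
    1 + (X ^ suc h + k * X ^ h)                         ≤⟨ +-monoˡ-≤ _ (m^n>0 X h) ⟩
    -- The base of the power is chosen for this recurrence: increasing n by 1 adds `suc k` to `X`,
    -- exactly enough for the empty word and the `k` other letters.
    X ^ h + (X * X ^ h + k * X ^ h)                     ≡⟨ lem k n (X ^ h) ⟩
    suc k * suc (suc n) * X ^ h                         ≤⟨ *-monoʳ-≤ (suc k * suc (suc n)) (^-monoˡ-≤ h (*-monoʳ-≤ (suc k) (n≤1+n (suc n)))) ⟩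
    (suc k * suc (suc n)) ^ suc h                       ∎
    where
    open ≤-Reasoning
    X = suc k * suc n
    next : Digit k → List (Expansion k)
    next a = List.map (a ∷_) (acceptedFrom (δ q a) n)
    lem : ∀ k n x → x + (suc k * suc n * x + k * x) ≡ suc k * suc (suc n) * x
    lem = solve-∀
    next-≤ : ∀ a h → rank (δ q a) < h → length (next a) ≤ X ^ h
    next-≤ a h rk = ≤-trans (≤-reflexive (length-map (a ∷_) (acceptedFrom (δ q a) n)))
      (acceptedFrom-≤ ¬pump h (δ q a) (reachable-trans r (a ∷ [] , refl)) rk n)
    drop-≤ : ∀ a → ¬ Reachable (δ q a) q → length (next a) ≤ X ^ h
    drop-≤ a ¬r = next-≤ a h (≤-trans (rank-step-< q a ¬r) (≤-pred rk))
    children : length (concat (List.tabulate next)) ≤ X ^ suc h + k * X ^ h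
    children with Fin.any? (λ a → reachable? (δ q a) q)
    ... | yes (a , back) = length-concat-tabulate-≤-except next a
            (next-≤ a (suc h) (≤-<-trans (rank-step-≤ q a) rk))
            (λ b b≢a → drop-≤ b λ back′ → ¬pump (q , r , live , a , b , b≢a ∘ sym , back , back′))
    ... | no  none       = ≤-trans (length-concat-tabulate-≤ next λ a → drop-≤ a λ back → none (a , back))
                             (m≤n+m _ (X ^ suc h))

  module _ {S : Pred ℕ 0ℓ} (rec : Recognises A S) (2≤k : 2 ≤ k) where
    open Recognised A S rec

    expansion-length : ∀ {n x} w → Accepts A w → fromDigits w ≡ n → n ≤ x → length w ≤ suc ⌊log₂ x ⌋
    expansion-length          []      _  _    _   = z≤n
    expansion-length {n} {x} (d ∷ w) w∈ refl n≤x = s≤s (begin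
      length w                     ≡⟨ ⌊log₂[2^n]⌋≡n (length w) ⟨
      ⌊log₂ 2 ^ length w ⌋         ≤⟨ ⌊log₂⌋-mono-≤ (≤-trans (^-monoˡ-≤ (length w) 2≤k)
                                       (≤-trans (canonical-≥ d w (accepted⇒canonical (d ∷ w) w∈)) n≤x)) ⟩
      ⌊log₂ x ⌋                    ∎)
      where open ≤-Reasoning

    ¬pumpable⇒sparse : ¬ Pumpable → (S? : Decidable S) → Sparse S?
    -- The exponent `suc s` exceeds the rank of every state. Words have at most lg + 1 letters, and
    -- lg + 2 ≤ 3 lg because lg ≥ 1 for x ≥ 2.
    ¬pumpable⇒sparse ¬pump S? = suc s , (suc k * 3) ^ suc s , 2 , bound
      where
      bound : ∀ x → 2 ≤ x → π S? x ≤ (suc k * 3) ^ suc s * ⌊log₂ x ⌋ ^ suc s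
      bound x 2≤x = begin
        π S? x                              ≤⟨ unique-⊆⇒length-≤ (Unique.filter⁺ S? (Unique.upTo⁺ (suc x))) sub ⟩
        length (List.map fromDigits words)  ≡⟨ length-map fromDigits words ⟩
        length words                        ≤⟨ acceptedFrom-≤ ¬pump (suc s) start ([] , refl) (s≤s (∣p∣≤n (reach start))) (suc lg) ⟩
        (suc k * (2 + lg)) ^ suc s          ≤⟨ ^-monoˡ-≤ (suc s) (*-monoʳ-≤ (suc k) (+-monoˡ-≤ lg (*-monoʳ-≤ 2 1≤lg))) ⟩
        (suc k * (2 * lg + lg)) ^ suc s     ≡⟨ cong (_^ suc s) (lem (suc k) lg) ⟩
        (suc k * 3 * lg) ^ suc s            ≡⟨ ^-distribʳ-* (suc k * 3) lg (suc s) ⟩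
        (suc k * 3) ^ suc s * lg ^ suc s    ∎
        where
        open ≤-Reasoning hiding (start)
        lg = ⌊log₂ x ⌋
        1≤lg : 1 ≤ lg
        1≤lg = ⌊log₂⌋-mono-≤ {2} {x} 2≤x
        words = acceptedFrom start (suc lg)
        lem : ∀ k l → k * (2 * l + l) ≡ k * 3 * l
        lem = solve-∀
        sub : filter S? (upTo (suc x)) ⊆ List.map fromDigits words
        sub {n} n∈ with ∈-filter⁻ S? {xs = upTo (suc x)} n∈
        ... | n∈upTo , n∈S with expansion 2≤k n n∈S
        ...   | w , w∈ , eq , _ = subst (Mem._∈ _) eq
          (∈-map⁺ fromDigits (acceptedFrom-complete start (suc lg) w w∈
            (expansion-length w w∈ eq (≤-pred (∈-upTo⁻ n∈upTo)))))

-- The bound for a given automaton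

last-++ : ∀ {A : Set} {P : Pred A 0ℓ} (xs : List A) y ys →
          Maybe.All P (last (xs ++ y ∷ ys)) → Maybe.All P (last (y ∷ ys))
last-++ []            y ys p = p
last-++ (x ∷ [])      y ys p = p
last-++ (x ∷ x′ ∷ xs) y ys p = last-++ (x′ ∷ xs) y ys p

sumOfAtMost-mono : ∀ {N N′ S n} → N ≤ N′ → SumOfAtMost N S n → SumOfAtMost N′ S n
sumOfAtMost-mono N≤N′ (xs , 1≤ , ≤N , xs∈S , eq) = xs , 1≤ , ≤-trans ≤N N≤N′ , xs∈S , eq

-- Here `p` is `k` to the number s of states: u and v have at most s letters, the loops y and z at
-- most 2s, and `X` is k^(2s). The count comes to at most p⁵ + 8p¹¹ and the threshold to at most
-- 4p¹³ + p⁷, both well inside the exponent 16.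
module PowerBounds (p : ℕ) ⦃ _ : NonZero p ⦄ {κ A B D X : ℕ}
  (K≤ : suc κ ≤ p ^ 2) (A≤ : A ≤ p ^ 1) (B≤ : B ≤ p ^ 1) (D≤ : D ≤ p ^ 3) (X≤ : X ≤ p ^ 2) where
  private
    mul : ∀ i j {a b} → a ≤ p ^ i → b ≤ p ^ j → a * b ≤ p ^ (i + j)
    mul i j a≤ b≤ = ≤-trans (*-mono-≤ a≤ b≤) (≤-reflexive (sym (^-distribˡ-+-* p i j)))

    up : ∀ i j {a} {_ : True (i ≤? j)} → a ≤ p ^ i → a ≤ p ^ j
    up i j {_} {i≤j} a≤ = ≤-trans a≤ (^-monoʳ-≤ p (toWitness i≤j))

    KAB≤ : suc κ * (A * B) ≤ p ^ 4
    KAB≤ = mul 2 2 K≤ (mul 1 1 A≤ B≤)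

    Z≤ : X * D * X ≤ p ^ 7
    Z≤ = mul 5 2 (mul 2 3 X≤ D≤) X≤

    R = 2 * (suc κ * (A * B) + X * D * X)

    R≤ : R ≤ 2 * (p ^ 7 + p ^ 7)
    R≤ = *-monoʳ-≤ 2 (+-mono-≤ (up 4 7 KAB≤) Z≤)

  count-≤ : X * D + R * (2 * suc κ) * κ ≤ 9 * p ^ 16
  count-≤ = begin
    X * D + R * (2 * suc κ) * κ                        ≤⟨ +-mono-≤ (up 5 16 (mul 2 3 X≤ D≤))
                                                            (*-mono-≤ (*-mono-≤ R≤ (*-monoʳ-≤ 2 K≤)) (≤-trans (n≤1+n κ) K≤)) ⟩
    p ^ 16 + 2 * (p ^ 7 + p ^ 7) * (2 * p ^ 2) * p ^ 2 ≡⟨ cong (p ^ 16 +_) (lem (p ^ 7) (p ^ 2)) ⟩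
    p ^ 16 + 8 * (p ^ 7 * p ^ 2 * p ^ 2)               ≤⟨ +-monoʳ-≤ (p ^ 16) (*-monoʳ-≤ 8 (up 11 16 (mul 9 2 (mul 7 2 ≤-refl ≤-refl) ≤-refl))) ⟩
    9 * p ^ 16                                         ∎
    where
    open ≤-Reasoning
    lem : ∀ x y → 2 * (x + x) * (2 * y) * y ≡ 8 * (x * y * y)
    lem = solve-∀

  size-≤ : ∀ {b} → b ≤ suc κ * (A * B) * suc κ ^ 1 → R * b + X * D * X ≤ 5 * p ^ 16
  size-≤ {b} b≤ = begin
    R * b + X * D * X                        ≤⟨ +-mono-≤ (*-mono-≤ R≤ (≤-trans b≤ (mul 4 2 KAB≤ (≤-trans (≤-reflexive (*-identityʳ (suc κ))) K≤)))) (up 7 16 Z≤) ⟩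
    2 * (p ^ 7 + p ^ 7) * p ^ 6 + p ^ 16     ≡⟨ lem (p ^ 7) (p ^ 6) (p ^ 16) ⟩
    p ^ 16 + 4 * (p ^ 7 * p ^ 6)             ≤⟨ +-monoʳ-≤ (p ^ 16) (*-monoʳ-≤ 4 (up 13 16 (mul 7 6 ≤-refl ≤-refl))) ⟩
    5 * p ^ 16                               ∎
    where
    open ≤-Reasoning
    lem : ∀ x y z → 2 * (x + x) * y + z ≡ z + 4 * (x * y)
    lem = solve-∀

module Basis {k} (2≤k : 2 ≤ k) (A : DFA k) (S : Pred ℕ 0ℓ) (rec : Recognises A S)
             (S? : Decidable S) (gcd≡1 : IsGCD S 1) where
  open DFA A using (start; final; δ)
  open Reachability A
  open Recognised A S rec
  open Growth A using (¬pumpable⇒sparse)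

  private
    p = k ^ s
    X = k ^ (2 * s)

    instance
      k≢0 : NonZero k
      k≢0 = >-nonZero (≤-trans (s≤s z≤n) 2≤k)

      p≢0 : NonZero p
      p≢0 = m^n≢0 k s

    k^≤ : ∀ {l} i → l ≤ s * i → k ^ l ≤ p ^ i
    k^≤ i l≤ = ≤-trans (^-monoʳ-≤ k l≤) (≤-reflexive (sym (^-*-assoc k s i)))

    k^[16s+_] : ∀ i → k ^ (16 * s + i) ≡ k ^ i * p ^ 16
    k^[16s+ i ] = trans (^-distribˡ-+-* k (16 * s) i)
      (trans (*-comm (k ^ (16 * s)) (k ^ i))
        (cong (k ^ i *_) (trans (cong (k ^_) (*-comm 16 s)) (sym (^-*-assoc k s 16)))))

    -- The gcd left by `residue-span` divides all elements of S below `X`, hence by pumping all of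
    -- S, hence 1. The predicate also records `x ≤ X`, which turns the bound on the number of
    -- summands into one on their sum.
    residues : ∀ D ⦃ _ : NonZero D ⦄ n →
      ∃[ xs ] All S xs × length xs ≤ X * D × sum xs ≤ X * D * X ×
              (∃[ a ] ∃[ b ] sum xs + a * D ≡ n + b * D)
    residues D n with residue-span {λ x → S x × x ≤ X} D (filter S? (upTo X))
                        (All.tabulate λ {x} x∈ → let x∈upTo , x∈S = ∈-filter⁻ S? {xs = upTo X} x∈ in
                                                 x∈S , <⇒≤ (∈-upTo⁻ x∈upTo))
    ... | g , _ , g∣small , span with span n (∣-trans (proj₂ gcd≡1 g g∣S) (1∣ n))
      where
      g∣S : ∀ x → S x → g ∣ x
      g∣S x x∈S with expansion 2≤k x x∈S
      ... | w , w∈ , eq , _ = subst (g ∣_) eq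
        (divides-small⇒divides g (λ y y∈S y<X → All.lookup g∣small (∈-filter⁺ S? (∈-upTo⁺ y<X) y∈S)) w w∈)
    ... | xs , pxs , len , cong-D =
      xs , All.map proj₁ pxs , len≤ ,
      ≤-trans (sum-bounded xs (All.map proj₂ pxs)) (*-monoˡ-≤ X len≤) , cong-D
      where
      len≤ : length xs ≤ X * D
      len≤ = ≤-trans len (*-monoˡ-≤ D (≤-trans (length-filter S? (upTo X)) (≤-reflexive (length-upTo X))))

  module Loops {q} (u v y z : Expansion k)
    (u-path : foldl δ start u ≡ q) (v-path : foldl δ q v ∈ final)
    (y-loop : foldl δ q y ≡ q) (z-loop : foldl δ q z ≡ q)
    (∣u∣≤ : length u ≤ s) (∣v∣≤ : length v ≤ s) (1≤∣y∣ : 1 ≤ length y) (∣y∣≤ : length y ≤ s * 2)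
    (∣y∣≡∣z∣ : length y ≡ length z) (y<z : fromDigits y < fromDigits z) where

    private
      κ = pred (k ^ length y)
      Y = fromDigits y
      Δ = fromDigits z ∸ Y
      V = fromDigits v

      K≡ : suc κ ≡ k ^ length y
      K≡ = suc-pred (k ^ length y) ⦃ m^n≢0 k (length y) ⦄

      pumped-word : ∀ {t x} → Pumped (suc κ) Y Δ V t x → ∃[ w ] foldl δ q w ∈ final × fromDigits w ≡ x
      pumped-word tail     = v , v-path , refl
      pumped-word (low pu) with pumped-word pu
      ... | w , w∈ , refl = y ++ w ,
        subst (_∈ final) (sym (trans (foldl-++ δ q y w) (cong (λ r → foldl δ r w) y-loop))) w∈ ,
        trans (fromDigits-++ y w) (cong (λ K → Y + K * fromDigits w) (sym K≡))
      pumped-word (high pu) with pumped-word pu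
      ... | w , w∈ , refl = z ++ w ,
        subst (_∈ final) (sym (trans (foldl-++ δ q z w) (cong (λ r → foldl δ r w) z-loop))) w∈ ,
        trans (fromDigits-++ z w)
          (cong₂ (λ a K → a + K * fromDigits w) (sym (m+[n∸m]≡n (<⇒≤ y<z)))
            (trans (cong (k ^_) (sym ∣y∣≡∣z∣)) (sym K≡)))

      accepted : ∀ w → foldl δ q w ∈ final → Accepts A (u ++ w)
      accepted w w∈ = subst (_∈ final) (sym (trans (foldl-++ δ start u w) (cong (λ r → foldl δ r w) u-path))) w∈

      pumped∈S : ∀ {t x} → Pumped (suc κ) Y Δ V t x → S (fromDigits u + k ^ length u * x)
      pumped∈S pu with pumped-word pu
      ... | w , w∈ , refl = subst S (fromDigits-++ u w) (accepted⇒∈ (u ++ w) (accepted w w∈))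

      nonzero : ∀ w → 1 ≤ length w → foldl δ q w ∈ final → 1 ≤ fromDigits w
      nonzero (d ∷ w) _ w∈ = ≤-trans (m^n>0 k (length w))
        (canonical-≥ d w (last-++ u d w (accepted⇒canonical (u ++ d ∷ w) (accepted (d ∷ w) w∈))))

      -- The accepted word u y v is canonical, and its leading digit lies in the nonempty y v even
      -- if v is empty. A positive value here makes `least` grow beyond every n.
      1≤Y+KV : 1 ≤ Y + suc κ * V
      1≤Y+KV = ≤-trans
        (nonzero (y ++ v) (≤-trans 1≤∣y∣ (≤-trans (m≤m+n (length y) (length v)) (≤-reflexive (sym (length-++ y)))))
          (subst (_∈ final) (sym (trans (foldl-++ δ q y v) (cong (λ r → foldl δ r v) y-loop))) v-path))
        (≤-reflexive (trans (fromDigits-++ y v) (cong (λ K → Y + K * V) (sym K≡))))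

      1≤Δ : 1 ≤ Δ
      1≤Δ = m<n⇒0<n∸m y<z

      D = k ^ length u * Δ

      instance
        D≢0 : NonZero D
        D≢0 = >-nonZero (*-mono-≤ (m^n>0 k (length u)) 1≤Δ)

      D≤ : D ≤ p ^ 3
      D≤ = ≤-trans (*-mono-≤ (k^≤ 1 (≤-trans ∣u∣≤ (≤-reflexive (sym (*-identityʳ s)))))
             (≤-trans (m∸n≤m _ Y) (≤-trans (<⇒≤ (fromDigits-< z))
               (k^≤ 2 (≤-trans (≤-reflexive (sym ∣y∣≡∣z∣)) ∣y∣≤)))))
             (≤-reflexive (sym (^-distribˡ-+-* p 1 2)))

      open PumpedBasis S κ (fromDigits u) (k ^ length u) Y Δ V (k ^ length v) (X * D) (X * D * X)
        (≤-pred (≤-trans (≤-trans 2≤k (≤-trans (≤-reflexive (sym (^-identityʳ k))) (^-monoʳ-≤ k 1≤∣y∣))) (≤-reflexive (sym K≡))))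
        (fromDigits-< u) 1≤Δ (fromDigits-< v) 1≤Y+KV
        (subst (Y <_) (sym K≡) (fromDigits-< y)) pumped∈S (residues D)

      open PowerBounds p {κ} {k ^ length u} {k ^ length v} {D} {X}
        (≤-trans (≤-reflexive K≡) (k^≤ 2 ∣y∣≤))
        (k^≤ 1 (≤-trans ∣u∣≤ (≤-reflexive (sym (*-identityʳ s)))))
        (k^≤ 1 (≤-trans ∣v∣≤ (≤-reflexive (sym (*-identityʳ s)))))
        D≤ (k^≤ 2 (≤-reflexive (*-comm 2 s)))

    loops-basis : ∀ n → 3 * k ^ (16 * s + 5) ≤ n → SumOfAtMost (5 * k ^ (16 * s + 3)) S n
    loops-basis n M≤n = sumOfAtMost-mono N≤ (pumped-basis n (≤-trans M≤ M≤n))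
      where
      -- The numerical factors are absorbed by the additional powers of `k`: 9 ≤ 5 · 2³ here and 5 ≤
      -- 3 · 2⁵ for the threshold.
      N≤ : _ ≤ 5 * k ^ (16 * s + 3)
      N≤ = ≤-trans count-≤ (≤-trans (*-monoˡ-≤ (p ^ 16) (≤-trans (m≤m+n 9 31) (*-monoʳ-≤ 5 (^-monoˡ-≤ 3 2≤k))))
             (≤-reflexive (trans (*-assoc 5 (k ^ 3) (p ^ 16)) (cong (5 *_) (sym k^[16s+ 3 ])))))
      M≤ : _ ≤ 3 * k ^ (16 * s + 5)
      M≤ = ≤-trans (size-≤ (block≤ 1)) (≤-trans (*-monoˡ-≤ (p ^ 16) (≤-trans (m≤m+n 5 91) (*-monoʳ-≤ 3 (^-monoˡ-≤ 5 2≤k))))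
             (≤-reflexive (trans (*-assoc 3 (k ^ 5) (p ^ 16)) (cong (3 *_) (sym k^[16s+ 5 ])))))

  private
    loop : ∀ {q} x y → foldl δ q x ≡ q → foldl δ q y ≡ q → foldl δ q (x ++ y) ≡ q
    loop {q} x y x-loop y-loop = trans (foldl-++ δ q x y) (trans (cong (λ r → foldl δ r y) x-loop) y-loop)

    len≤ : ∀ (x y : Expansion k) → length x ≤ s → length y ≤ s → length (x ++ y) ≤ s * 2
    len≤ x y x≤ y≤ = ≤-trans (≤-reflexive (length-++ x))
      (≤-trans (+-mono-≤ x≤ y≤) (≤-reflexive (trans (cong (s +_) (sym (+-identityʳ s))) (*-comm 2 s))))

  pumpable-basis : Pumpable → ∀ n → 3 * k ^ (16 * s + 5) ≤ n → SumOfAtMost (5 * k ^ (16 * s + 3)) S n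
  pumpable-basis (q , start→q , (f , q→f , f∈) , a , b , a≢b , a→q , b→q)
    with short-reach start→q | short-reach q→f | short-reach a→q | short-reach b→q
  ... | u , u< , u-path | v , v< , v-path | r , r< , r-path | t , t< , t-path
    with <-cmp (fromDigits (c ++ d)) (fromDigits (d ++ c))
    where
    c = a ∷ r
    d = b ∷ t
  -- The two concatenations begin with the distinct letters `a` and `b`. These are their least
  -- significant digits, so the values differ, and the smaller one takes the role of y₀.
  ... | tri≈ _ eq _ = contradiction (fromDigits-head a b (r ++ b ∷ t) (t ++ a ∷ r) eq) a≢b
  ... | tri< lt _ _ = Loops.loops-basis u v (a ∷ r ++ b ∷ t) (b ∷ t ++ a ∷ r) u-path (subst (_∈ final) (sym v-path) f∈)
                        (loop (a ∷ r) (b ∷ t) r-path t-path) (loop (b ∷ t) (a ∷ r) t-path r-path)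
                        (<⇒≤ u<) (<⇒≤ v<) (s≤s z≤n) (len≤ (a ∷ r) (b ∷ t) r< t<) (length-++-comm (a ∷ r) (b ∷ t)) lt
  ... | tri> _ _ gt = Loops.loops-basis u v (b ∷ t ++ a ∷ r) (a ∷ r ++ b ∷ t) u-path (subst (_∈ final) (sym v-path) f∈)
                        (loop (b ∷ t) (a ∷ r) t-path r-path) (loop (a ∷ r) (b ∷ t) r-path t-path)
                        (<⇒≤ u<) (<⇒≤ v<) (s≤s z≤n) (len≤ (b ∷ t) (a ∷ r) t< r<) (length-++-comm (b ∷ t) (a ∷ r)) gt

  -- Non-sparseness is only a negation; deciding `Pumpable` turns it into an actual state with two
  -- loops.
  nonsparse-basis : ¬ Sparse S? → ∀ n → 3 * k ^ (16 * s + 5) ≤ n → SumOfAtMost (5 * k ^ (16 * s + 3)) S n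
  nonsparse-basis ¬sparse with pumpable?
  ... | yes pump = pumpable-basis pump
  ... | no ¬pump = contradiction (¬pumpable⇒sparse rec 2≤k ¬pump S?) ¬sparse

-- Minimal automata

leastWitness : {P : Pred ℕ 0ℓ} → Decidable P → ∀ n → P n → ∃[ m ] P m × (∀ i → P i → m ≤ i)
leastWitness P? n pn with P? 0
... | yes p0 = 0 , p0 , λ _ _ → z≤n
leastWitness P? zero    p0 | no ¬p0 = contradiction p0 ¬p0
leastWitness {P} P? (suc n) pn | no ¬p0 with leastWitness (P? ∘ suc) n pn
... | m , pm , min = suc m , pm , λ { zero p0 → contradiction p0 ¬p0 ; (suc i) pi → s≤s (min i pi) }

_≈_ : ∀ {k} → DFA k → DFA k → Set
A ≈ B = ∀ w → Accepts A w ⇔ Accepts B w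

accepts? : ∀ {k} (A : DFA k) → Decidable (Accepts A)
accepts? A w = foldl (DFA.δ A) (DFA.start A) w ∈? DFA.final A

module _ {k} (A B : DFA k) where
  private
    Agree : Pred (Expansion k) 0ℓ
    Agree w = Accepts A w ⇔ Accepts B w

    agree? : Decidable Agree
    agree? w = map′ (uncurry mk⇔) (λ e → Equivalence.to e , Equivalence.from e)
      ((accepts? A w →-dec accepts? B w) ×-dec (accepts? B w →-dec accepts? A w))

    Q : Set
    Q = Fin (states A) × Fin (states B)

    δ : Q → Digit k → Q
    δ (p , q) d = DFA.δ A p d , DFA.δ B q d

    δ-run : ∀ p q w → foldl δ (p , q) w ≡ (foldl (DFA.δ A) p w , foldl (DFA.δ B) q w)
    δ-run p q []      = refl
    δ-run p q (d ∷ w) = δ-run (DFA.δ A p d) (DFA.δ B q d) w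

    code-injective : ∀ {x y : Q} → uncurry combine x ≡ uncurry combine y → x ≡ y
    code-injective {p , q} {p′ , q′} eq with Fin.combine-injective p q p′ q′ eq
    ... | refl , refl = refl

    -- In the product of the two automata some short word reaches the same pair of states as `w`,
    -- and this pair decides both acceptances.
    short-agreement : (∀ w → length w < states A * states B → Agree w) → A ≈ B
    short-agreement agree w
      with short-path (uncurry combine) code-injective δ (DFA.start A , DFA.start B) w
    ... | v , v< , eq = subst (λ x → proj₁ x ∈ DFA.final A ⇔ proj₂ x ∈ DFA.final B)
      (trans (sym (δ-run _ _ v)) (trans eq (δ-run _ _ w))) (agree v v<)

  _≈?_ : Dec (A ≈ B)
  _≈?_ with anyWord? (λ w → ¬? (agree? w)) (states A * states B)
  ... | yes (w , _ , differ) = no λ A≈B → differ (A≈B w)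
  ... | no  none = yes (short-agreement λ w w< →
                     decidable-stable (agree? w) λ differ → none (w , w< , differ))

≈-trans : ∀ {k} {A B C : DFA k} → A ≈ B → B ≈ C → A ≈ C
≈-trans A≈B B≈C w = B≈C w ⇔-∘ A≈B w

≈-sym : ∀ {k} {A B : DFA k} → A ≈ B → B ≈ A
≈-sym A≈B w = ⇔-sym (A≈B w)

recognises-≈ : ∀ {k S} {A B : DFA k} → Recognises A S → Recognises B S → A ≈ B
recognises-≈ recA recB w = ⇔-sym (recB w) ⇔-∘ recA w

≈-recognises : ∀ {k S} {A B : DFA k} → A ≈ B → Recognises A S → Recognises B S
≈-recognises A≈B recA w = recA w ⇔-∘ ⇔-sym (A≈B w)

-- The transition table is coded in two layers, `s` rows in `Fin (s ^ k)`, so that the automata with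
-- `s` states can be searched exhaustively.
decode : ∀ {k} s → Fin s → Subset s → Fin ((s ^ k) ^ s) → DFA k
decode s q F i = record { states = s ; start = q ; final = F ; δ = λ p → finToFun (finToFun i p) }

-- Decoding recovers the transition function only pointwise, so the comparison is by accepted words
-- rather than by equality of automata.
decode-complete : ∀ {k} (A : DFA k) → ∃[ i ] decode (states A) (DFA.start A) (DFA.final A) i ≈ A
decode-complete {k} A = funToFin (λ p → funToFin (δ p)) , λ w →
  subst (λ q → q ∈ final ⇔ Accepts A w) (sym (run start w)) (⇔-id _)
  where
  open DFA A using (start; final; δ)
  run : ∀ q w → foldl (λ p → finToFun (finToFun (funToFin (λ p → funToFin (δ p))) p)) q w ≡ foldl δ q w
  run q []      = refl
  run q (d ∷ w) = trans
    (cong (λ p → foldl _ p w)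
      (trans (cong (λ f → finToFun f d) (Fin.finToFun-funToFin (λ p → funToFin (δ p)) q))
             (Fin.finToFun-funToFin (δ q) d)))
    (run (δ q d) w)

RealisedBy : ∀ {k} → DFA k → ℕ → Set
RealisedBy {k} A n = Σ[ B ∈ DFA k ] states B ≡ n × B ≈ A

realisedBy? : ∀ {k} (A : DFA k) → Decidable (RealisedBy A)
realisedBy? A n = map′
  (λ { (q , F , i , eq) → decode n q F i , refl , eq })
  (λ { (B , refl , B≈A) → let i , eq = decode-complete B in
        DFA.start B , DFA.final B , i , ≈-trans eq B≈A })
  (Fin.any? λ q → anySubset? λ F → Fin.any? λ i → decode n q F i ≈? A)

minimise : ∀ {k} (A : DFA k) → ∃[ n ] RealisedBy A n × (∀ i → RealisedBy A i → n ≤ i)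
minimise A = leastWitness (realisedBy? A) (states A) (A , refl , λ w → ⇔-id _)

minStates : ∀ {k} → DFA k → ℕ
minStates A = proj₁ (minimise A)

minStates-≤ : ∀ {k} {A : DFA k} (B : DFA k) → B ≈ A → minStates A ≤ states B
minStates-≤ {A = A} B B≈A = proj₂ (proj₂ (minimise A)) (states B) (B , refl , B≈A)

minStates-mono : ∀ {k} {A B : DFA k} → A ≈ B → minStates A ≤ minStates B
minStates-mono {A = A} {B} A≈B = lower (proj₁ (proj₂ (minimise B)))
  where
  lower : ∀ {n} → RealisedBy B n → minStates A ≤ n
  lower (C , refl , C≈B) = minStates-≤ C (≈-trans C≈B (≈-sym A≈B))

bound : ℕ → ℕ → DFAAlgorithm
bound c i k A = c * k ^ (16 * minStates A + i)

bound-computes : ∀ c i {k S} (A : DFA k) → Recognises A S → Computes (bound c i) k S (bound c i k A)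
bound-computes c i {k} A recA B recB = cong (λ m → c * k ^ (16 * m + i))
  (≤-antisym (minStates-mono (recognises-≈ recB recA)) (minStates-mono (recognises-≈ recA recB)))

bound-≤ : ∀ {k S} → 2 ≤ k → ∀ c i {A : DFA k} (B : DFA k) → Recognises A S → Recognises B S →
          bound c i k A ≤ c * k ^ (16 * states B + i)
bound-≤ {k} 2≤k c i B recA recB = *-monoʳ-≤ c (^-monoʳ-≤ k ⦃ >-nonZero (≤-trans (s≤s z≤n) 2≤k) ⦄
  (+-monoˡ-≤ i (*-monoʳ-≤ 16 (minStates-≤ B (recognises-≈ recB recA)))))

-- The construction is run on the smallest equivalent automaton instead of the given one, so the
-- exponent contains the minimal number of states.
realised-basis : ∀ {k m S} (A : DFA k) → 2 ≤ k → Recognises A S → (S? : Decidable S) →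
                 ¬ Sparse S? → IsGCD S 1 → RealisedBy A m →
                 ∀ n → 3 * k ^ (16 * m + 5) ≤ n → SumOfAtMost (5 * k ^ (16 * m + 3)) S n
realised-basis {S = S} A 2≤k recA S? ¬sparse gcd≡1 (B , refl , B≈A) =
  Basis.nonsparse-basis 2≤k B S (≈-recognises (≈-sym B≈A) recA) S? gcd≡1 ¬sparse

theorem4p1 : Σ[ algN ∈ DFAAlgorithm ] Σ[ algM ∈ DFAAlgorithm ]
    ((k : ℕ) (2≤k : 2 ≤ k) (S : Pred ℕ 0ℓ) (aut : Automatic k S) →
    ¬ Sparse (automatic⇒decidable 2≤k aut) →
    IsGCD S 1 →
    ∃[ N ] ∃[ M ]
    (Computes algN k S N × Computes algM k S M ×
    (∀ n → M ≤ n → SumOfAtMost N S n) ×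
    (∀ (A : DFA k) → IsMinimalDFA A S →
    N ≤ 5 * k ^ (16 * states A + 3) ×
    M ≤ 3 * k ^ (16 * states A + 5))))
theorem4p1 = bound 5 3 , bound 3 5 , λ k 2≤k S (A , recA) ¬sparse gcd≡1 →
  bound 5 3 k A , bound 3 5 k A ,
  bound-computes 5 3 A recA , bound-computes 3 5 A recA ,
  realised-basis A 2≤k recA (automatic⇒decidable 2≤k (A , recA)) ¬sparse gcd≡1
    (proj₁ (proj₂ (minimise A))) ,
  λ B (recB , _) → bound-≤ 2≤k 5 3 B recA recB , bound-≤ 2≤k 3 5 B recA recB
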